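{- For a positive integer $n \equiv 0 \pmod 4$, let $F_1$ and $F_2$ be graphs on a common set of $n$ vertices, both of which are isomorphic to the vertex-disjoint union of $n/4$ copies of the $4$-cycle $C_4$. Then $\gamma_{\rm sd}(F_1,F_2) = n/2$.
   Context: All graphs are finite and simple. Given graphs $F_1, F_2$ (called factors; not necessarily edge-disjoint) with common vertex set $V$, a set $S \subseteq V$ is a simultaneous dominating set if for each $i \in \{1,2\}$ every vertex not in $S$ is adjacent in $F_i$ to some vertex of $S$. The simultaneous domination number $\gamma_{\rm sd}(F_1,F_2)$ is the minimum cardinality of a simultaneous dominating set. -}

module Defs where

open import Data.Fin.Base using (Fin; zero; suc; toℕ)
open import Data.Fin.Subset using (Subset; _∈_; _∉_; ∣_∣)
open import Data.Nat.Base using (ℕ; suc; _≤_; _%_)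
open import Data.Product.Base using (_×_; _,_; ∃-syntax)
open import Data.Sum.Base using (_⊎_; inj₁; inj₂; swap)
open import Function.Bundles using (_↔_; _⇔_; Inverse)
open import Level using (0ℓ)
open import Relation.Binary.Core using (Rel)
open import Relation.Binary.Definitions using (Symmetric; Irreflexive)
open import Relation.Binary.PropositionalEquality using (_≡_; refl; sym)

-- Simple graphs. Adjacency need not be decidable a priori.
record Graph (V : Set) : Set₁ where
  field
    Adj    : Rel V 0ℓ
    symm   : Symmetric Adj
    irrefl : Irreflexive _≡_ Adj

open Graph public

record _≅_ {V W : Set} (F : Graph V) (G : Graph W) : Set where
  field
    bijection : V ↔ W
    adjacency : ∀ u v → Adj F u v ⇔ Adj G (Inverse.to bijection u) (Inverse.to bijection v)

infix 4 _≅_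

C₄ : Graph (Fin 4)
C₄ = record
  { Adj    = λ u v → toℕ v ≡ suc (toℕ u) % 4 ⊎ toℕ u ≡ suc (toℕ v) % 4
  ; symm   = swap
  ; irrefl = λ { {u} refl (inj₁ p) → noLoop u p ; {u} refl (inj₂ p) → noLoop u p }
  }
  where
  open import Relation.Nullary.Negation.Core using (¬_)

  noLoop : ∀ (u : Fin 4) → ¬ (toℕ u ≡ suc (toℕ u) % 4)
  noLoop zero ()
  noLoop (suc zero) ()
  noLoop (suc (suc zero)) ()
  noLoop (suc (suc (suc zero))) ()

-- The vertex-disjoint union of k copies of G; (i , v) is the vertex v of
-- the i-th copy.
copies : ∀ {V} (k : ℕ) → Graph V → Graph (Fin k × V)
copies k G = record
  { Adj    = λ { (i , u) (j , v) → i ≡ j × Adj G u v }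
  ; symm   = λ { (i≡j , uv) → sym i≡j , symm G uv }
  ; irrefl = λ { refl (_ , uu) → irrefl G refl uu }
  }

Dominates : ∀ {n} → Subset n → Graph (Fin n) → Set
Dominates S F = ∀ v → v ∉ S → ∃[ u ] (u ∈ S × Adj F v u)

SimultaneousDominating : ∀ {n} (F₁ F₂ : Graph (Fin n)) → Subset n → Set
SimultaneousDominating F₁ F₂ S = Dominates S F₁ × Dominates S F₂

-- γsd F₁ F₂ ≔ k  says that k is the minimum cardinality of a simultaneous
-- dominating set. It is a relation because computing the minimum would
-- require decidable adjacency.
record γsd_,_≔_ {n} (F₁ F₂ : Graph (Fin n)) (k : ℕ) : Set where
  field
    attained : ∃[ S ] (SimultaneousDominating F₁ F₂ S × ∣ S ∣ ≡ k)
    minimal  : ∀ S → SimultaneousDominating F₁ F₂ S → k ≤ ∣ S ∣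

infix 4 γsd_,_≔_

{-# OPTIONS --safe #-}

-- Choosing two opposite edges in every 4-cycle gives perfect matchings of F₁
-- and F₂. The union of two perfect matchings has only even cycles, so it is
-- 2-colourable, and one colour class S contains exactly one end of every
-- matching edge: S has n/2 elements, and a vertex outside S is dominated by
-- its partner in either matching. Conversely a set dominating F₁ must contain
-- at least two vertices of every 4-cycle.
module Submission where

open import Defs
open import Data.Bool.Base using (Bool; true; false; not; _∧_; _∨_; _xor_; if_then_else_)
open import Data.Bool.Properties using (not-involutive; not-distribʳ-xor; ∨-comm)
open import Data.Fin.Base using (Fin; zero; suc; combine; remQuot; punchIn; punchOut; _↑ˡ_; _↑ʳ_)
open import Data.Fin.Permutation using (transpose)
import Data.Fin.Permutation.Components as PC
open import Data.Fin.Properties using (_≟_; _<?_; <-asym; <-cmp; *↔×; remQuot-combine; punchIn-punchOut)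
open import Data.Fin.Subset using (Subset; _∈_; ∣_∣; inside; outside)
open import Data.List.Base using (List; []; _∷_; allFin)
open import Data.List.Membership.Propositional.Properties using (∈-allFin)
open import Data.List.Relation.Unary.All as All using (All; []; _∷_)
open import Data.Nat.Base using (ℕ; NonZero; zero; suc; _+_; _*_; _/_; _%_; _≤_; z≤n)
open import Data.Nat.DivMod using (m*n/n≡m; m/n*n≡m)
open import Data.Nat.Divisibility using (m%n≡0⇒n∣m)
open import Data.Nat.Properties
  using (+-0-commutativeMonoid; m≤m+n; +-monoʳ-≤; +-assoc; +-mono-≤; *-assoc; *-identityʳ; *-suc;
         module ≤-Reasoning)
open import Algebra.Properties.CommutativeMonoid.Sum +-0-commutativeMonoid
  using (sum; sum-syntax; sum-cong-≗; sum-permute; sum-remove; ∑-distrib-+)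
open import Data.Product.Base using (_×_; _,_; ∃-syntax; proj₂)
open import Data.Sum.Base using (_⊎_; inj₁; inj₂)
open import Data.Vec.Base using ([]; _∷_; lookup; tabulate)
open import Data.Vec.Properties using (lookup∘tabulate; lookup⇒[]=; []=⇒lookup)
open import Function.Base using (_∘_)
open import Function.Bundles using (_↔_; Inverse; Equivalence; mk↔ₛ′)
open import Function.Construct.Composition using (_↔-∘_)
open import Function.Construct.Symmetry using (↔-sym)
open import Relation.Binary.Definitions using (tri<; tri≈; tri>)
open import Relation.Binary.PropositionalEquality
open import Relation.Nullary using (¬_; Dec; yes; no; does; contradiction)
open import Relation.Nullary.Decidable using (dec-true; dec-false)

-- Perfect matchings as fixed-point-free involutions

record Matching (A : Set) : Set where
  field
    partner      : A → A
    involutive   : ∀ x → partner (partner x) ≡ x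
    partner-≢    : ∀ x → partner x ≢ x

open Matching

ProperFor : {A : Set} → Matching A → (A → Bool) → Set
ProperFor M f = ∀ x → f (partner M x) ≡ not (f x)

transport : {A B : Set} → A ↔ B → Matching A → Matching B
transport π M = record
  { partner    = λ y → to (partner M (from y))
  ; involutive = λ y → trans
      (cong (to ∘ partner M) (strictlyInverseʳ (partner M (from y))))
      (trans (cong to (involutive M (from y))) (strictlyInverseˡ y))
  ; partner-≢  = λ y eq → partner-≢ M (from y)
      (trans (sym (strictlyInverseʳ _)) (cong from eq))
  }
  where open Inverse π

-- Rewiring a matching, and colourings proper for two matchings at once

module _ {n : ℕ} where

  transpose-matchˡ : ∀ (i j : Fin n) → PC.transpose i j i ≡ j
  transpose-matchˡ i j rewrite dec-true (i ≟ i) refl = refl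

  transpose-matchʳ : ∀ (i j : Fin n) → PC.transpose i j j ≡ i
  transpose-matchʳ i j with j ≟ i
  ... | yes j≡i = j≡i
  ... | no  _ rewrite dec-true (j ≟ j) refl = refl

  transpose-mismatch : ∀ {i j k : Fin n} → k ≢ i → k ≢ j → PC.transpose i j k ≡ k
  transpose-mismatch {i} {j} {k} k≢i k≢j
    rewrite dec-false (k ≟ i) k≢i | dec-false (k ≟ j) k≢j = refl

  -- The order of `Fin n` tells the two ends of an edge apart: the smaller end is coloured `true`.
  proper-exists : (M : Matching (Fin n)) → ∃[ f ] ProperFor M f
  proper-exists M = (λ x → does (x <? partner M x)) , proper
    where
    proper : ∀ x → does (partner M x <? partner M (partner M x)) ≡ not (does (x <? partner M x))
    proper x rewrite involutive M x with <-cmp x (partner M x)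
    ... | tri< lt _ _ rewrite dec-true (x <? partner M x) lt =
      dec-false (partner M x <? x) (<-asym lt)
    ... | tri≈ _ eq _ = contradiction (sym eq) (partner-≢ M x)
    ... | tri> _ _ gt rewrite dec-true (partner M x <? x) gt =
      sym (cong not (dec-false (x <? partner M x) (<-asym gt)))

  onPair : Fin n → Fin n → Fin n → Bool
  onPair u v x = does (x ≟ u) ∨ does (x ≟ v)

  onPair-false : ∀ {u v x} → x ≢ u → x ≢ v → onPair u v x ≡ false
  onPair-false {u} {v} {x} x≢u x≢v
    rewrite dec-false (x ≟ u) x≢u | dec-false (x ≟ v) x≢v = refl

  onPair-left : ∀ u v → onPair u v u ≡ true
  onPair-left u v rewrite dec-true (u ≟ u) refl = refl

  onPair-right : ∀ u v → onPair u v v ≡ true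
  onPair-right u v rewrite dec-true (v ≟ v) refl = ∨-comm (does (v ≟ u)) true

  -- The pair is an edge of `M`, hence closed under `partner M`.
  onPair-partner : (M : Matching (Fin n)) → ∀ u x →
    onPair u (partner M u) (partner M x) ≡ onPair u (partner M u) x
  onPair-partner M u x with x ≟ u | x ≟ partner M u
  ... | yes refl | _        = onPair-right x (partner M x)
  ... | no _     | yes refl rewrite involutive M u = onPair-left u _
  ... | no x≢u   | no x≢Mu  = onPair-false
    (λ Mx≡u → x≢Mu (trans (sym (involutive M x)) (cong (partner M) Mx≡u)))
    (λ Mx≡Mu → x≢u (trans (sym (involutive M x))
      (trans (cong (partner M) Mx≡Mu) (involutive M u))))

  -- Replaces the edges {u , M u} and {v , M v} by {u , v} and {M u , M v}.
  rewire : Matching (Fin n) → Fin n → Fin n → Matching (Fin n)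
  rewire M u v = transport (transpose (partner M u) v) M

  -- The flag `b` lets one formula cover both flipping and leaving `f` alone; which one is required
  -- depends on the colours that `f` happens to give.
  flipOn : Bool → Fin n → Fin n → (Fin n → Bool) → Fin n → Bool
  flipOn b u v f x = (b ∧ onPair u v x) xor f x

  module _ (M : Matching (Fin n)) {u v : Fin n} (u≢v : u ≢ v) (Mu≢v : partner M u ≢ v)
    where
    private
      m = partner M

    m-injective : ∀ {x y} → m x ≡ m y → x ≡ y
    m-injective {x} {y} eq =
      trans (sym (involutive M x)) (trans (cong m eq) (involutive M y))

    Mv≢u : m v ≢ u
    Mv≢u eq = Mu≢v (trans (cong m (sym eq)) (involutive M v))

    rewire-u : partner (rewire M u v) u ≡ v
    rewire-u rewrite transpose-mismatch {v} {m u} {u} u≢v (partner-≢ M u ∘ sym) =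
      transpose-matchˡ (m u) v

    rewire-Mu : partner (rewire M u v) (m u) ≡ m v
    rewire-Mu rewrite transpose-matchʳ v (m u) =
      transpose-mismatch (u≢v ∘ sym ∘ m-injective) (partner-≢ M v)

    rewire-other : ∀ {x} → x ≢ u → x ≢ v → x ≢ m u → x ≢ m v →
      partner (rewire M u v) x ≡ m x
    rewire-other {x} x≢u x≢v x≢Mu x≢Mv rewrite transpose-mismatch x≢v x≢Mu =
      transpose-mismatch (x≢u ∘ m-injective)
        (λ Mx≡v → x≢Mv (trans (sym (involutive M x)) (cong m Mx≡v)))

    -- The rewired edges force `f v` and `f (m v)` to be opposite to `f u` and `f (m u)`. So the
    -- edges of `M` at `u` and at `v` are both proper or both monochromatic, and in the second case
    -- flipping `u` and `v` repairs both.
    proper-unrewire : ∀ {f} → ProperFor (rewire M u v) f →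
      ∃[ b ] ProperFor M (flipOn b u v f)
    proper-unrewire {f} proper = b , proper′
      where
      -- True exactly when the edge `{u , m u}` is monochromatic.
      b = not (f (m u) xor f u)
      g = flipOn b u v f

      -- Properness at one end of an edge gives it at the other, so `u` and `v` account for all four
      -- affected vertices.
      symmetric : ∀ {x} → g (m x) ≡ not (g x) → g (m (m x)) ≡ not (g (m x))
      symmetric {x} eq = trans (cong g (involutive M x))
        (trans (sym (not-involutive (g x))) (cong not (sym eq)))

      outer : ∀ {x} → x ≢ u → x ≢ v → g x ≡ f x
      outer {x} x≢u x≢v rewrite onPair-false x≢u x≢v with b
      ... | true  = refl
      ... | false = refl

      fv : f v ≡ not (f u)
      fv = trans (cong f (sym rewire-u)) (proper u)

      fMv : f (m v) ≡ not (f (m u))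
      fMv = trans (cong f (sym rewire-Mu)) (proper (m u))

      at-u : g (m u) ≡ not (g u)
      at-u rewrite outer (partner-≢ M u) Mu≢v | onPair-left u v with f (m u) | f u
      ... | true  | true  = refl
      ... | true  | false = refl
      ... | false | true  = refl
      ... | false | false = refl

      at-v : g (m v) ≡ not (g v)
      at-v rewrite outer Mv≢u (partner-≢ M v) | onPair-right u v | fv | fMv
        with f (m u) | f u
      ... | true  | true  = refl
      ... | true  | false = refl
      ... | false | true  = refl
      ... | false | false = refl

      proper′ : ProperFor M g
      proper′ x = cases (x ≟ u) (x ≟ v) (x ≟ m u) (x ≟ m v)
        where
        open ≡-Reasoning
        swap-m : ∀ {y} → m x ≡ y → x ≡ m y
        swap-m eq = trans (sym (involutive M x)) (cong m eq)

        cases : Dec (x ≡ u) → Dec (x ≡ v) → Dec (x ≡ m u) → Dec (x ≡ m v) → g (m x) ≡ not (g x)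
        cases (yes refl) _ _ _ = at-u
        cases _ (yes refl) _ _ = at-v
        cases _ _ (yes refl) _ = symmetric at-u
        cases _ _ _ (yes refl) = symmetric at-v
        -- Away from the four affected vertices the edge at `x` is the same in both matchings, and
        -- neither of its ends is flipped.
        cases (no x≢u) (no x≢v) (no x≢Mu) (no x≢Mv) = begin
          g (m x)                      ≡⟨ outer (x≢Mu ∘ swap-m) (x≢Mv ∘ swap-m) ⟩
          f (m x)                      ≡⟨ cong f (rewire-other x≢u x≢v x≢Mu x≢Mv) ⟨
          f (partner (rewire M u v) x) ≡⟨ proper x ⟩
          not (f x)                    ≡⟨ cong not (outer x≢u x≢v) ⟨
          not (g x)                    ∎

  -- Each edge of `M` has both ends flipped or neither, and a common flip keeps opposite colours
  -- opposite.
  flipOn-proper : (M : Matching (Fin n)) → ∀ b u f {x} →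
    f (partner M x) ≡ not (f x) →
    flipOn b u (partner M u) f (partner M x) ≡ not (flipOn b u (partner M u) f x)
  flipOn-proper M b u f {x} eq rewrite onPair-partner M u x | eq =
    sym (not-distribʳ-xor (b ∧ onPair u (partner M u) x) (f x))

  -- Induction on the list of vertices at which M must be respected, for all
  -- matchings N at once: N is rewired so as to contain the edge {u , M u}, and
  -- flipping both ends of that edge keeps every edge of M proper.
  common-proper-on : (M N : Matching (Fin n)) (us : List (Fin n)) →
    ∃[ f ] (ProperFor N f × All (λ u → f (partner M u) ≡ not (f u)) us)
  common-proper-on M N [] with f , proper ← proper-exists N = f , proper , []
  common-proper-on M N (u ∷ us) with partner N u ≟ partner M u
  ... | yes Nu≡Mu with f , proper , rest ← common-proper-on M N us =
    f , proper , trans (cong f (sym Nu≡Mu)) (proper u) ∷ rest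
  ... | no Nu≢Mu
    with f , proper , rest ← common-proper-on M (rewire N u (partner M u)) us
    with b , proper′ ← proper-unrewire N (partner-≢ M u ∘ sym) Nu≢Mu proper
    = flipOn b u (partner M u) f , proper′ ,
      All.map (flipOn-proper M b u f)
        -- The rewired matching joins `u` to `partner M u`, so `f` already separates them; this
        -- supplies the list entry for `u` before the flip.
        (trans (cong f (sym (rewire-u N (partner-≢ M u ∘ sym) Nu≢Mu))) (proper u) ∷ rest)

  common-proper : (M N : Matching (Fin n)) → ∃[ f ] (ProperFor M f × ProperFor N f)
  common-proper M N with f , properN , properM ← common-proper-on M N (allFin n) =
    f , (λ x → All.lookup properM (∈-allFin x)) , properN

-- Cardinalities as sums, and the size of a colour class

𝟙 : Bool → ℕ
𝟙 b = if b then 1 else 0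

∣∣≡sum : ∀ {n} (S : Subset n) → ∣ S ∣ ≡ sum (𝟙 ∘ lookup S)
∣∣≡sum []            = refl
∣∣≡sum (inside  ∷ S) = cong suc (∣∣≡sum S)
∣∣≡sum (outside ∷ S) = ∣∣≡sum S

∣tabulate∣≡sum : ∀ {n} (f : Fin n → Bool) → ∣ tabulate f ∣ ≡ sum (𝟙 ∘ f)
∣tabulate∣≡sum f = trans (∣∣≡sum (tabulate f)) (sum-cong-≗ (cong 𝟙 ∘ lookup∘tabulate f))

sum-constant : ∀ n c → ∑[ i < n ] c ≡ n * c
sum-constant zero    c = refl
sum-constant (suc n) c = cong (c +_) (sum-constant n c)

sum-↑ : ∀ m {n} (f : Fin (m + n) → ℕ) → sum f ≡ sum (f ∘ (_↑ˡ n)) + sum (f ∘ (m ↑ʳ_))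
sum-↑ zero    f = refl
sum-↑ (suc m) f = trans (cong (f zero +_) (sum-↑ m (f ∘ suc))) (sym (+-assoc (f zero) _ _))

-- `combine` enumerates `Fin (m * n)` in consecutive blocks of length `n`, so the induction splits
-- off the first block.
sum-combine : ∀ m {n} (f : Fin (m * n) → ℕ) → sum f ≡ ∑[ i < m ] ∑[ j < n ] f (combine i j)
sum-combine zero        f = refl
sum-combine (suc m) {n} f = 
  trans (sum-↑ n f) (cong (sum (f ∘ (_↑ˡ m * n)) +_) (sum-combine m (f ∘ (n ↑ʳ_))))

sum-lower : ∀ n {c} (f : Fin n → ℕ) → (∀ i → c ≤ f i) → n * c ≤ sum f
sum-lower zero    f c≤f = z≤n
sum-lower (suc n) f c≤f = +-mono-≤ (c≤f zero) (sum-lower n (f ∘ suc) (c≤f ∘ suc))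

term≤sum : ∀ {n} (f : Fin n → ℕ) i → f i ≤ sum f
term≤sum {suc n} f i = subst (f i ≤_) (sym (sum-remove {i = i} f)) (m≤m+n (f i) _)

two-terms≤sum : ∀ {n} (f : Fin n → ℕ) {i j} → i ≢ j → f i + f j ≤ sum f
two-terms≤sum {suc n} f {i} {j} i≢j = begin
  -- Once `i` is removed, `j` survives at position `punchOut i≢j` of the remaining sum.
  f i + f j                                 ≡⟨ cong (λ x → f i + f x) (punchIn-punchOut i≢j) ⟨
  f i + f (punchIn i (punchOut i≢j))        ≤⟨ +-monoʳ-≤ (f i) (term≤sum (f ∘ punchIn i) (punchOut i≢j)) ⟩
  f i + sum (f ∘ punchIn i)                 ≡⟨ sum-remove {i = i} f ⟨
  sum f                                     ∎
  where open ≤-Reasoning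

-- Double counting: `partner M` is a permutation, so summing over partners gives the same total,
-- while each vertex and its partner together contribute exactly 1.
proper-halves : ∀ {n} (M : Matching (Fin n)) {f} → ProperFor M f → sum (𝟙 ∘ f) * 2 ≡ n
proper-halves {n} M {f} proper = begin
  s * 2                                   ≡⟨ *-suc s 1 ⟩
  s + s * 1                               ≡⟨ cong (s +_) (*-identityʳ s) ⟩
  s + s                                   ≡⟨ cong (s +_) (sum-permute (𝟙 ∘ f) π) ⟩
  s + sum (𝟙 ∘ f ∘ partner M)             ≡⟨ ∑-distrib-+ (𝟙 ∘ f) _ ⟨
  ∑[ x < n ] (𝟙 (f x) + 𝟙 (f (partner M x))) ≡⟨ sum-cong-≗ complementary ⟩
  ∑[ x < n ] 1                            ≡⟨ sum-constant n 1 ⟩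
  n * 1                                   ≡⟨ *-identityʳ n ⟩
  n                                       ∎
  where
  open ≡-Reasoning
  s = sum (𝟙 ∘ f)
  π = mk↔ₛ′ (partner M) (partner M) (involutive M) (involutive M)
  complementary : ∀ x → 𝟙 (f x) + 𝟙 (f (partner M x)) ≡ 1
  complementary x rewrite proper x with f x
  ... | true  = refl
  ... | false = refl

-- Perfect matchings in disjoint 4-cycles, and domination by a colour class

C₄-partner : Fin 4 → Fin 4
C₄-partner zero                   = suc zero
C₄-partner (suc zero)             = zero
C₄-partner (suc (suc zero))       = suc (suc (suc zero))
C₄-partner (suc (suc (suc zero))) = suc (suc zero)

C₄-matching : Matching (Fin 4)
C₄-matching = record
  { partner    = C₄-partner
  ; involutive = λ { zero → refl ; (suc zero) → refl
                   ; (suc (suc zero)) → refl ; (suc (suc (suc zero))) → refl }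
  ; partner-≢  = λ { zero () ; (suc zero) ()
                   ; (suc (suc zero)) () ; (suc (suc (suc zero))) () }
  }

C₄-matching-edge : ∀ x → Adj C₄ x (C₄-partner x)
C₄-matching-edge zero                   = inj₁ refl
C₄-matching-edge (suc zero)             = inj₂ refl
C₄-matching-edge (suc (suc zero))       = inj₁ refl
C₄-matching-edge (suc (suc (suc zero))) = inj₂ refl

copies-matching : ∀ {V} k → Matching V → Matching (Fin k × V)
copies-matching k M = record
  { partner    = λ (i , x) → i , partner M x
  ; involutive = λ (i , x) → cong (i ,_) (involutive M x)
  ; partner-≢  = λ (i , x) eq → partner-≢ M x (cong proj₂ eq)
  }

module _ {n k} {F : Graph (Fin n)} (F≅ : F ≅ copies k C₄) where
  open _≅_ F≅
  open Inverse bijection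

  C₄s-matching : Matching (Fin n)
  C₄s-matching = transport (↔-sym bijection) (copies-matching k C₄-matching)

  C₄s-matching-edge : ∀ v → Adj F v (partner C₄s-matching v)
  C₄s-matching-edge v = Equivalence.from (adjacency v _)
    (subst (Adj (copies k C₄) (to v)) (sym (strictlyInverseˡ _))
      (refl , C₄-matching-edge (proj₂ (to v))))

  proper⇒Dominates : ∀ {f} → ProperFor C₄s-matching f → Dominates (tabulate f) F
  proper⇒Dominates {f} proper v v∉S =
    partner C₄s-matching v , member (trans (proper v) (cong not fv≡false)) , C₄s-matching-edge v
    where
    member : ∀ {x} → f x ≡ true → x ∈ tabulate f
    member {x} fx = lookup⇒[]= x _ (trans (lookup∘tabulate f x) fx)

    fv≡false : f v ≡ false
    fv≡false with f v in eq
    ... | true  = contradiction (member eq) v∉S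
    ... | false = refl

-- Lower bound for sets dominating disjoint 4-cycles

C₄-antipode : Fin 4 → Fin 4
C₄-antipode zero                   = suc (suc zero)
C₄-antipode (suc zero)             = suc (suc (suc zero))
C₄-antipode (suc (suc zero))       = zero
C₄-antipode (suc (suc (suc zero))) = suc zero

-- The disjunction is membership in the closed neighbourhood of the antipode, the form in which
-- `near` delivers a dominating vertex.
C₄-antipode-far : ∀ x → ¬ (x ≡ C₄-antipode x ⊎ Adj C₄ (C₄-antipode x) x)
C₄-antipode-far zero                   (inj₂ (inj₁ ()))
C₄-antipode-far zero                   (inj₂ (inj₂ ()))
C₄-antipode-far (suc zero)             (inj₂ (inj₁ ()))
C₄-antipode-far (suc zero)             (inj₂ (inj₂ ()))
C₄-antipode-far (suc (suc zero))       (inj₂ (inj₁ ()))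
C₄-antipode-far (suc (suc zero))       (inj₂ (inj₂ ()))
C₄-antipode-far (suc (suc (suc zero))) (inj₂ (inj₁ ()))
C₄-antipode-far (suc (suc (suc zero))) (inj₂ (inj₂ ()))

-- The antipode of a vertex y of the set is not dominated by y, which forces a
-- second vertex into the set.
C₄-dominating-≥2 : (h : Fin 4 → Bool) →
  (∀ x → h x ≡ false → ∃[ y ] (h y ≡ true × Adj C₄ x y)) → 2 ≤ sum (𝟙 ∘ h)
C₄-dominating-≥2 h dom =
  -- The start `zero` is arbitrary; it only serves to produce some vertex of the set.
  let y , hy , _     = near zero
      z , hz , close = near (C₄-antipode y)
      y≢z            = λ y≡z → C₄-antipode-far y
                         (subst (λ w → w ≡ C₄-antipode y ⊎ Adj C₄ (C₄-antipode y) w) (sym y≡z) close)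
  in subst (_≤ sum (𝟙 ∘ h)) (cong₂ (λ a b → 𝟙 a + 𝟙 b) hy hz) (two-terms≤sum (𝟙 ∘ h) y≢z)
  where
  near : ∀ x → ∃[ y ] (h y ≡ true × (y ≡ x ⊎ Adj C₄ x y))
  near x with h x in eq
  ... | true  = x , eq , inj₁ refl
  ... | false with y , hy , xy ← dom x eq = y , hy , inj₂ xy

-- Adjacency never leaves a copy, so the part of `S` in each copy dominates that copy and has at
-- least two elements; these parts are disjoint.
dominating-C₄s-≥ : ∀ {n k} {F : Graph (Fin n)} → F ≅ copies k C₄ →
  ∀ S → Dominates S F → k * 2 ≤ ∣ S ∣
dominating-C₄s-≥ {n} {k} {F} F≅ S dom = begin
  k * 2                                                    ≤⟨ sum-lower k _ copy-≥2 ⟩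
  ∑[ i < k ] ∑[ j < 4 ] 𝟙 (h (i , j))                      ≡⟨ sum-cong-≗ {k} (λ i → sum-cong-≗ {4} λ j →
                                                                cong (𝟙 ∘ h) (remQuot-combine i j)) ⟨
  ∑[ i < k ] ∑[ j < 4 ] 𝟙 (h (remQuot {k} 4 (combine i j))) ≡⟨ sum-combine k (𝟙 ∘ h ∘ remQuot {k} 4) ⟨
  -- The vertices are reindexed along the composite bijection from `Fin (k * 4)` through
  -- `Fin k × Fin 4` to `Fin n`.
  sum (𝟙 ∘ h ∘ remQuot {k} 4)                              ≡⟨ sum-permute (𝟙 ∘ lookup S) (↔-sym bijection ↔-∘ *↔×) ⟨
  sum (𝟙 ∘ lookup S)                                       ≡⟨ ∣∣≡sum S ⟨
  ∣ S ∣                                                    ∎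
  where
  open ≤-Reasoning
  open _≅_ F≅
  open Inverse bijection

  h : Fin k × Fin 4 → Bool
  h = lookup S ∘ from

  copy-dominating : ∀ i x → h (i , x) ≡ false → ∃[ y ] (h (i , y) ≡ true × Adj C₄ x y)
  copy-dominating i x hx
    with u , u∈S , vu ← dom (from (i , x))
           (λ v∈S → contradiction (trans (sym hx) ([]=⇒lookup v∈S)) λ ())
    -- Matching on `refl` places the dominating vertex `u` in copy `i`.
    with refl , xy ← subst (λ p → Adj (copies k C₄) p (to u)) (strictlyInverseˡ (i , x))
           (Equivalence.to (adjacency _ u) vu)
    = proj₂ (to u) , trans (cong (lookup S) (strictlyInverseʳ u)) ([]=⇒lookup u∈S) , xy

  copy-≥2 : ∀ i → 2 ≤ ∑[ j < 4 ] 𝟙 (h (i , j))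
  copy-≥2 i = C₄-dominating-≥2 (λ j → h (i , j)) (copy-dominating i)

theorem24 : (n : ℕ) → .{{_ : NonZero n}} → n % 4 ≡ 0 →
    (F₁ F₂ : Graph (Fin n)) →
    F₁ ≅ copies (n / 4) C₄ → F₂ ≅ copies (n / 4) C₄ →
    γsd F₁ , F₂ ≔ (n / 2)
theorem24 n n%4≡0 F₁ F₂ F₁≅ F₂≅
  with f , proper₁ , proper₂ ← common-proper (C₄s-matching F₁≅) (C₄s-matching F₂≅)
  = record
    { attained = tabulate f , (proper⇒Dominates F₁≅ proper₁ , proper⇒Dominates F₂≅ proper₂) ,
                 sym (half (trans (cong (_* 2) (∣tabulate∣≡sum f)) (proper-halves (C₄s-matching F₁≅) proper₁)))
    ; minimal  = λ S (dom₁ , _) → subst (_≤ ∣ S ∣) (sym (half n/4*2*2≡n)) (dominating-C₄s-≥ F₁≅ S dom₁)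
    }
  where
  -- Both bounds arrive as a number whose double is `n`, which identifies that number with `n / 2`.
  half : ∀ {m} → m * 2 ≡ n → n / 2 ≡ m
  half {m} refl = m*n/n≡m m 2

  n/4*2*2≡n : n / 4 * 2 * 2 ≡ n
  n/4*2*2≡n = trans (*-assoc (n / 4) 2 2) (m/n*n≡m (m%n≡0⇒n∣m n 4 n%4≡0))
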